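{- There is no spherical tiling by $12$ edge congruent pentagons in which the edge lengths of the pentagon are $a,a,a,b,c$ with $a,b,c$ distinct.
   Context: A spherical tiling is given by a finite connected graph nicely embedded in $S^2$ (edges may be any reasonably nice curves, not necessarily great arcs) with all vertices of degree $\ge 3$; the tiles are the closures of the connected components of the complement. All tiles are pentagons (five edges) with no boundary points identified (each tile is enclosed by a simple closed curve). Each edge of the graph has a length. Two polygons are edge congruent if there is a correspondence between their edges that preserves adjacency of edges and preserves edge lengths. In a tiling by edge congruent pentagons, any two tiles are edge congruent. The edge lengths $a,a,a,b,c$ are given as an unordered combination; their cyclic arrangement in the pentagon is arbitrary. -}

module Defs where

open import Level using (_⊔_)
open import Data.Bool.Base using (Bool; true; false; not)
open import Data.Fin.Base using (Fin)
open import Data.Fin.Properties using (_≟_)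
open import Data.List.Base
  using (List; []; _∷_; map; filter; length; iterate; allFin; cartesianProduct)
open import Data.List.Relation.Unary.Unique.Propositional using (Unique)
import Data.List.Relation.Binary.Permutation.Setoid as Permutation
open import Data.Nat.Base using (ℕ; _+_; _≤_)
open import Data.Product.Base using (Σ; ∃-syntax; _×_; _,_; proj₁)
open import Data.Sum.Base using (_⊎_)
open import Function.Bundles using (_↔_; _⇔_; module Inverse)
import Function.Endo.Propositional as Endo
open import Relation.Binary.Bundles using (Setoid)
open import Relation.Binary.Construct.Closure.ReflexiveTransitive using (Star)
open import Relation.Binary.PropositionalEquality using (_≡_)

-- A finite multigraph, loops allowed.  A dart is an edge together with one of
-- its two directions, so a loop gives two darts at its vertex.
record Graph : Set where
  field
    #vertices #edges : ℕ

  Vertex : Set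
  Vertex = Fin #vertices

  Edge : Set
  Edge = Fin #edges

  Dart : Set
  Dart = Edge × Bool

  field
    source : Dart → Vertex

  edge : Dart → Edge
  edge = proj₁

  reverse : Dart → Dart
  reverse (e , b) = e , not b

  target : Dart → Vertex
  target d = source (reverse d)

  darts : List Dart
  darts = cartesianProduct (allFin #edges) (false ∷ true ∷ [])

  degree : Vertex → ℕ
  degree v = length (filter (λ d → source d ≟ v) darts)

  Neighbours : Vertex → Vertex → Set
  Neighbours u v = ∃[ d ] (source d ≡ u × target d ≡ v)

  Connected : Set
  Connected = ∀ u v → Star Neighbours u v

-- For a permutation of a finite type this is "x and y lie in the same cycle".
SameCycle : ∀ {a} {A : Set a} → (A → A) → A → A → Set a
SameCycle {A = A} f x y = ∃[ k ] (f ^ k) x ≡ y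
  where open Endo A using (_^_)

-- A connected graph embedded in the sphere with all degrees at least 3,
-- presented by its rotation system (Heffter–Edmonds): up to orientation
-- preserving homeomorphism, the embeddings of a connected graph in closed
-- oriented surfaces with disks as complementary regions correspond to the
-- choices of a cyclic order of the darts at each vertex, and the surface is
-- the sphere exactly when Euler's formula holds.  In the sphere, the
-- complementary regions of a connected graph are always disks.
record SphericalTiling : Set where
  field
    graph : Graph
  open Graph graph public

  field
    connected : Connected
    degree≥3  : ∀ v → 3 ≤ degree v

    -- The next dart, clockwise, with the same source.
    rotation       : Dart ↔ Dart
    rotation-cycle : ∀ d d′ → source d ≡ source d′ ⇔
                              SameCycle (Inverse.to rotation) d d′

  -- The next dart along the boundary of the region to the left of d: arrive
  -- at the target of d and take the leftmost turn.
  next : Dart → Dart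
  next d = Inverse.to rotation (reverse d)

  field
    #tiles : ℕ

  Tile : Set
  Tile = Fin #tiles

  field
    -- The tile to the left of a dart.
    tile            : Dart → Tile
    tile-surjective : ∀ t → ∃[ d ] tile d ≡ t
    tile-cycle      : ∀ d d′ → tile d ≡ tile d′ ⇔ SameCycle next d d′

    euler : #vertices + #tiles ≡ #edges + 2

  -- The sides of a tile, as the darts having the tile on their left.
  Side : Tile → Set
  Side t = Σ Dart λ d → tile d ≡ t

  AdjacentSides : ∀ {t} → Side t → Side t → Set
  AdjacentSides (d , _) (d′ , _) = next d ≡ d′ ⊎ next d′ ≡ d

  -- The first five darts along the boundary of the tile to the left of d.
  boundary₅ : Dart → List Dart
  boundary₅ d = iterate next d 5

  -- The tile to the left of d has five edges, and its boundary is a simple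
  -- closed curve.
  record IsPentagon (d : Dart) : Set where
    field
      closed            : next (next (next (next (next d)))) ≡ d
      distinct-vertices : Unique (map source (boundary₅ d))
      distinct-edges    : Unique (map edge (boundary₅ d))

  AllPentagons : Set
  AllPentagons = ∀ d → IsPentagon d

-- Lengths are taken in an arbitrary setoid, for example the positive real
-- numbers in any construction: edges may be arbitrary curves, so only
-- equality between lengths is relevant.
module _ {c ℓ} (Length : Setoid c ℓ) (T : SphericalTiling) where
  open Setoid Length using (Carrier; _≈_)
  open Permutation Length using (_↭_)
  open SphericalTiling T

  module _ (len : Edge → Carrier) where

    record EdgeCongruent (s t : Tile) : Set ℓ where
      field
        correspondence      : Side s ↔ Side t
      open Inverse correspondence using (to)
      field
        preserves-adjacency : ∀ x y → AdjacentSides x y →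
                              AdjacentSides (to x) (to y)
        preserves-length    : ∀ x → len (edge (proj₁ (to x))) ≈
                                    len (edge (proj₁ x))

    -- For pentagons; the cyclic arrangement of the lengths is not prescribed.
    EdgeLengths : Tile → List Carrier → Set (c ⊔ ℓ)
    EdgeLengths t ls = ∀ d → tile d ≡ t →
                       map (λ d′ → len (edge d′)) (boundary₅ d) ↭ ls

    record IsTilingByEdgeCongruentPentagons (ls : List Carrier)
           : Set (c ⊔ ℓ) where
      field
        pentagons      : AllPentagons
        edge-congruent : ∀ s t → EdgeCongruent s t
        edge-lengths   : ∀ t → EdgeLengths t ls

{-# OPTIONS --safe #-}

-- Counting darts with Euler's formula shows that every vertex has degree 3.
-- By edge congruence, the b-edge and the c-edge are adjacent either in all
-- tiles or in none.
--
-- If in none, take a tile with consecutive sides b, a, c.  The tile across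
-- this a-edge has there three consecutive sides of length a, so its b-edge
-- and c-edge are adjacent after all.
--
-- If in all, the b-edges and c-edges form closed zigzags.  The tiles on one
-- side of a zigzag each have a side away from it, of length a, and these
-- sides together bound a further tile, which therefore has no b-edge.

module Submission where

open import Defs
open import Level using (Level; _⊔_)
open import Data.Bool.Base using (true; false)
open import Data.Bool.Properties using (not-involutive)
import Data.Bool.Properties as Bool
open import Data.Empty using (⊥)
open import Data.Fin.Base using (Fin; zero; suc)
open import Data.Fin.Properties using (_≟_)
open import Data.List.Base
  using (List; []; _∷_; _++_; map; filter; length; iterate; allFin; cartesianProduct)
open import Data.List.Membership.Propositional using (_∈_)
open import Data.List.Membership.Propositional.Properties
  using (∈-∃++; ∈-++⁻; ∈-++⁺ˡ; ∈-++⁺ʳ; ∈-allFin; ∈-cartesianProduct⁺; ∈-filter⁺; ∈-filter⁻)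
open import Data.List.Properties using (length-++; length-map; length-tabulate)
open import Data.List.Relation.Binary.Subset.Propositional using (_⊆_)
open import Data.List.Relation.Unary.All as All using ([]; _∷_)
open import Data.List.Relation.Unary.AllPairs as AllPairs using (AllPairs; []; _∷_)
import Data.List.Relation.Unary.AllPairs.Properties as AllPairs
open import Data.List.Relation.Unary.Any using (Any; here; there)
import Data.List.Relation.Unary.Any.Properties as Any
open import Data.List.Relation.Unary.Unique.Propositional using (Unique)
import Data.List.Relation.Unary.Unique.Propositional.Properties as Unique
import Data.List.Relation.Binary.Permutation.Setoid as Permutation
import Data.List.Relation.Binary.Permutation.Setoid.Properties as Permutationₚ
open import Data.Nat.Base using (ℕ; zero; suc; _+_; _*_; _≤_; z≤n; s≤s)
open import Data.Nat.Properties
  using (+-0-commutativeMonoid; +-suc; +-assoc; +-comm; +-cancelʳ-≡; *-suc; *-distribʳ-+;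
         ≤-trans; ≤-antisym; +-mono-≤; +-monoˡ-≤; +-monoʳ-≤; +-cancelˡ-≤; +-cancelʳ-≤;
         *-cancelʳ-≤; module ≤-Reasoning)
open import Algebra.Properties.CommutativeMonoid.Sum +-0-commutativeMonoid
  using (sum; sum-cong-≗; sum-replicate-zero; ∑-distrib-+)
open import Data.Product.Base using (Σ; ∃-syntax; _×_; _,_; proj₁; proj₂)
import Data.Product.Properties as Product
open import Data.Sum.Base using (_⊎_; inj₁; inj₂)
open import Function.Base using (_∘_; id)
open import Function.Bundles using (module Equivalence; module Inverse)
import Function.Endo.Propositional as Endo
open import Relation.Binary.Bundles using (Setoid)
open import Relation.Binary.PropositionalEquality
  using (_≡_; refl; sym; trans; cong; cong₂; subst; subst₂; module ≡-Reasoning)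
open import Relation.Nullary.Decidable using (Dec; yes; no; _⊎-dec_)
open import Relation.Nullary.Negation using (¬_; contradiction)

private
  variable
    a p q : Level
    A : Set a

-- Pentagonal maps with all vertices of degree 3

-- The darts of a map with pentagonal tiles and vertices of degree 3; the
-- next dart around the source of d is next (reverse d).
module CubicPentagonalMap {D : Set} (next reverse : D → D)
  (next⁵ : ∀ d → next (next (next (next (next d)))) ≡ d)
  (reverse² : ∀ d → reverse (reverse d) ≡ d)
  (rotation³ : ∀ d → next (reverse (next (reverse (next (reverse d))))) ≡ d)
  where

  open Endo D using (_^_)

  prev : D → D
  prev d = next (next (next (next d)))

  next≡⇒≡prev : ∀ {d e} → next d ≡ e → d ≡ prev e
  next≡⇒≡prev {d} refl = sym (next⁵ d)

  -- The remaining dart at the target of d, directed towards it.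
  side : D → D
  side d = reverse (next (reverse (next d)))

  -- Starting from `reverse d`, the turns about the target of `d` give `next d`, then
  -- `reverse (side d)`, then `reverse d` again by `rotation³`.
  next-side : ∀ d → next (side d) ≡ reverse d
  next-side d = trans (sym (cong (next ∘ side) (reverse² d))) (rotation³ (reverse d))

  -- Existence and uniqueness are list predicates on the boundary because these transport along the
  -- permutations in `EdgeLengths`.
  record OneEdgePerTile (P : D → Set p) : Set p where
    field
      reversed    : ∀ {d} → P d → P (reverse d)
      exists      : ∀ d → Any P (iterate next d 5)
      at-most-one : ∀ d → AllPairs (λ x y → P x → ¬ P y) (iterate next d 5)

    unreversed : ∀ {d} → P (reverse d) → P d
    unreversed {d} Pd = subst P (reverse² d) (reversed Pd)

    ¬next : ∀ {d} → P d → ¬ P (next d)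
    ¬next {d} Pd with at-most-one d
    ... | (¬P₁ ∷ _) ∷ _ = ¬P₁ Pd

    ¬next² : ∀ {d} → P d → ¬ P (next (next d))
    ¬next² {d} Pd with at-most-one d
    ... | (_ ∷ ¬P₂ ∷ _) ∷ _ = ¬P₂ Pd

    ¬next³ : ∀ {d} → P d → ¬ P (next (next (next d)))
    ¬next³ {d} Pd with at-most-one d
    ... | (_ ∷ _ ∷ ¬P₃ ∷ _) ∷ _ = ¬P₃ Pd

    exists^ : ∀ d → ∃[ k ] P ((next ^ k) d)
    exists^ d with exists d
    ... | here P₀                                 = 0 , P₀
    ... | there (here P₁)                         = 1 , P₁
    ... | there (there (here P₂))                 = 2 , P₂
    ... | there (there (there (here P₃)))         = 3 , P₃
    ... | there (there (there (there (here P₄)))) = 4 , P₄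

  module _ {P : D → Set p} {Q : D → Set q}
    (oneP : OneEdgePerTile P) (oneQ : OneEdgePerTile Q)
    where

    private
      module P = OneEdgePerTile oneP
      module Q = OneEdgePerTile oneQ

    -- Two distinguished edges that are never adjacent

    module _
      (disjoint : ∀ {d} → P d → ¬ Q d)
      (P⇒¬nextQ : ∀ {d} → P d → ¬ Q (next d))
      (Q⇒¬nextP : ∀ {d} → Q d → ¬ P (next d))
      where

      -- Only the last two sides remain for `P` and `Q`, and there they would coincide or be
      -- adjacent.
      nonadjacent⇒¬three-free-sides : ∀ d → ¬ P d → ¬ Q d →
        ¬ P (next d) → ¬ Q (next d) →
        ¬ P (next (next d)) → ¬ Q (next (next d)) → ⊥
      nonadjacent⇒¬three-free-sides d ¬P₀ ¬Q₀ ¬P₁ ¬Q₁ ¬P₂ ¬Q₂ with P.exists d | Q.exists d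
      ... | here P₀                 | _                       = ¬P₀ P₀
      ... | there (here P₁)         | _                       = ¬P₁ P₁
      ... | there (there (here P₂)) | _                       = ¬P₂ P₂
      ... | there (there (there _)) | here Q₀                 = ¬Q₀ Q₀
      ... | there (there (there _)) | there (here Q₁)         = ¬Q₁ Q₁
      ... | there (there (there _)) | there (there (here Q₂)) = ¬Q₂ Q₂
      ... | there (there (there (here P₃)))         | there (there (there (here Q₃)))         = disjoint P₃ Q₃
      ... | there (there (there (here P₃)))         | there (there (there (there (here Q₄)))) = P⇒¬nextQ P₃ Q₄
      ... | there (there (there (there (here P₄)))) | there (there (there (here Q₃)))         = Q⇒¬nextP Q₃ P₄
      ... | there (there (there (there (here P₄)))) | there (there (there (there (here Q₄)))) = disjoint P₄ Q₄

      -- In the tile across `next d`, this edge and both its neighbours are free: each neighbour is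
      -- also adjacent, in the tile across `d` or `next (next d)`, to the `P`-edge or the `Q`-edge.
      nonadjacent⇒¬two-apart : ∀ {d} → P d → ¬ Q (next (next d))
      nonadjacent⇒¬two-apart {d} P₀ Q₂ =
        nonadjacent⇒¬three-free-sides (side (next d))
          (λ Ps → Q⇒¬nextP (Q.reversed Q₂) (P.unreversed Ps))
          (λ Qs → Q.¬next (Q.reversed Q₂) (Q.unreversed Qs))
          (λ P₁ → P.¬next P₀ (P.unreversed (subst P (next-side (next d)) P₁)))
          (λ Q₁ → Q.¬next (Q.unreversed (subst Q (next-side (next d)) Q₁)) Q₂)
          -- In the tile across `d`, the dart `side d` comes just before `reverse d`.
          (λ Py → P.¬next (side-P Py) (subst P (sym (next-side d)) (P.reversed P₀)))
          (λ Qy → Q⇒¬nextP (side-Q Qy) (subst P (sym (next-side d)) (P.reversed P₀)))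
        where
        side-P : P (next (next (side (next d)))) → P (side d)
        side-P = P.reversed ∘ subst P (cong next (next-side (next d)))
        side-Q : Q (next (next (side (next d)))) → Q (side d)
        side-Q = Q.reversed ∘ subst Q (cong next (next-side (next d)))

    -- Two distinguished edges that are always adjacent: zigzags

    module _
      (P-adjacent : ∀ {d} → P d → Q (next d) ⊎ Q (prev d))
      (Q-adjacent : ∀ {d} → Q d → P (next d) ⊎ P (prev d))
      where

      PQ : D → Set (p ⊔ q)
      PQ d = P d × Q (next d)

      -- Two steps along the zigzag.
      advance : D → D
      advance d = next (reverse (next (next d)))

      -- The side that d and next d leave opposite in their tile, seen from
      -- the tile across it.
      opposite : D → D
      opposite d = reverse (next (next (next d)))

      -- Across the `Q`-edge, `P` must lie at the far end, since at the near end it would be next to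
      -- the `P`-edge `d` in the tile across `d`. In the tile of `advance d`, `Q` cannot come
      -- before: that side is `next (next d)` reversed, which shares a tile with the `Q`-edge
      -- `next d`.
      PQ-advance : ∀ {d} → PQ d → PQ (advance d)
      PQ-advance {d} (P₀ , Q₁) = Px , nextQ
        where
        ¬P-turn : ¬ P (next (reverse (next d)))
        ¬P-turn Py = P.¬next (P.reversed Py)
          (subst P (sym (next-side d)) (P.reversed P₀))
        Px : P (advance d)
        Px with Q-adjacent (Q.reversed Q₁)
        ... | inj₁ Py = contradiction Py ¬P-turn
        ... | inj₂ Ps = P.unreversed
          (subst P (sym (next≡⇒≡prev (next-side (next d)))) Ps)
        nextQ : Q (next (advance d))
        nextQ with P-adjacent Px
        ... | inj₁ Q₁′ = Q₁′
        ... | inj₂ Q₂ = contradiction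
          (Q.unreversed (subst Q (next⁵ (reverse (next (next d)))) Q₂)) (Q.¬next Q₁)

      -- The tiles of `d` and `advance d` share the edge of `next (next d)`. Their opposite sides
      -- meet at its far end, where degree 3 makes them successive sides of the tile beyond.
      opposite-advance : ∀ d → opposite (advance d) ≡ next (opposite d)
      opposite-advance d = begin
        -- By definition, three steps after `advance d` are four steps after
        -- `reverse (next (next d))`.
        reverse (prev (reverse (next (next d))))
          ≡⟨ cong reverse (next≡⇒≡prev (next-side (next (next d)))) ⟨
        reverse (side (next (next d)))
          ≡⟨ reverse² _ ⟩
        next (opposite d) ∎
        where open ≡-Reasoning

      next^-opposite : ∀ k {d} → PQ d → ∃[ e ] PQ e × opposite e ≡ (next ^ k) (opposite d)
      next^-opposite zero    PQd = _ , PQd , refl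
      next^-opposite (suc k) PQd with next^-opposite k PQd
      ... | e , PQe , eq = advance e , PQ-advance PQe ,
        trans (opposite-advance e) (cong next eq)

      -- The opposite sides run through a whole tile, so one of them is a `P`-edge. Its tile on the
      -- zigzag already has a `P`-edge three sides before.
      adjacent⇒¬PQ : ∀ {d} → ¬ PQ d
      adjacent⇒¬PQ {d} PQd with P.exists^ (opposite d)
      ... | k , Pk with next^-opposite k PQd
      ... | e , (P₀ , _) , eq = P.¬next³ P₀ (P.unreversed (subst P (sym eq) Pk))

  -- Exclusion of both cases

  module _ {P : D → Set p} {Q : D → Set q}
    (oneP : OneEdgePerTile P) (oneQ : OneEdgePerTile Q)
    where

    ¬nonadjacent : D →
      (∀ {d} → P d → ¬ Q d) →
      (∀ {d} → P d → ¬ Q (next d)) →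
      ¬ (∀ {d} → Q d → ¬ P (next d))
    ¬nonadjacent d₀ disjoint P⇒¬nextQ Q⇒¬nextP with OneEdgePerTile.exists^ oneP d₀
    ... | k , Pd with OneEdgePerTile.exists oneQ ((next ^ k) d₀)
    ... | here Q₀                                 = disjoint Pd Q₀
    ... | there (here Q₁)                         = P⇒¬nextQ Pd Q₁
    ... | there (there (here Q₂))                 =
      nonadjacent⇒¬two-apart oneP oneQ disjoint P⇒¬nextQ Q⇒¬nextP Pd Q₂
    -- `Q` three sides after `P` means `P` two sides after `Q`, so the roles are exchanged.
    ... | there (there (there (here Q₃)))         =
      nonadjacent⇒¬two-apart oneQ oneP (λ Qd Pd → disjoint Pd Qd) Q⇒¬nextP P⇒¬nextQ
        Q₃ (subst P (sym (next⁵ _)) Pd)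
    ... | there (there (there (there (here Q₄)))) =
      Q⇒¬nextP Q₄ (subst P (sym (next⁵ _)) Pd)

    ¬adjacent : D →
      (∀ {d} → P d → Q (next d) ⊎ Q (prev d)) →
      ¬ (∀ {d} → Q d → P (next d) ⊎ P (prev d))
    ¬adjacent d₀ P-adjacent Q-adjacent with OneEdgePerTile.exists^ oneP d₀
    ... | _ , Pd with P-adjacent Pd
    ... | inj₁ Q₁ = adjacent⇒¬PQ oneP oneQ P-adjacent Q-adjacent (Pd , Q₁)
    -- With `Q` before `P`, the zigzag is read with the roles exchanged, from `prev d`.
    ... | inj₂ Q₄ = adjacent⇒¬PQ oneQ oneP Q-adjacent P-adjacent
      (Q₄ , subst P (sym (next⁵ _)) Pd)

-- Counting in finite lists

length-cartesianProduct : ∀ {b} {B : Set b} (xs : List A) (ys : List B) →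
  length (cartesianProduct xs ys) ≡ length xs * length ys
length-cartesianProduct []       ys = refl
length-cartesianProduct (x ∷ xs) ys = begin
  length (map (x ,_) ys ++ cartesianProduct xs ys)
    ≡⟨ length-++ (map (x ,_) ys) ⟩
  length (map (x ,_) ys) + length (cartesianProduct xs ys)
    ≡⟨ cong₂ _+_ (length-map (x ,_) ys) (length-cartesianProduct xs ys) ⟩
  length ys + length xs * length ys ∎
  where open ≡-Reasoning

-- Delete the head of `xs` from `ys`; by uniqueness the tail of `xs` survives the deletion.
unique-⊆⇒length≤ : {xs ys : List A} → Unique xs → xs ⊆ ys → length xs ≤ length ys
unique-⊆⇒length≤ []                      _     = z≤n
unique-⊆⇒length≤ {xs = x ∷ xs} (x∉ ∷ xs!) xs⊆ys with ∈-∃++ (xs⊆ys (here refl))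
... | as , bs , refl = begin
  suc (length xs)               ≤⟨ s≤s (unique-⊆⇒length≤ xs! xs⊆as++bs) ⟩
  suc (length (as ++ bs))       ≡⟨ cong suc (length-++ as) ⟩
  suc (length as + length bs)   ≡⟨ +-suc (length as) (length bs) ⟨
  length as + suc (length bs)   ≡⟨ length-++ as ⟨
  length (as ++ x ∷ bs)         ∎
  where
  open ≤-Reasoning
  xs⊆as++bs : xs ⊆ as ++ bs
  xs⊆as++bs y∈xs with ∈-++⁻ as (xs⊆ys (there y∈xs))
  ... | inj₁ y∈as         = ∈-++⁺ˡ y∈as
  ... | inj₂ (here y≡x)   = contradiction (sym y≡x) (All.lookup x∉ y∈xs)
  ... | inj₂ (there y∈bs) = ∈-++⁺ʳ as y∈bs

fibre : ∀ {n} (f : A → Fin n) → List A → Fin n → List A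
fibre f xs v = filter (λ x → f x ≟ v) xs

-- The Kronecker delta, written as a fibre so that both sides of `length-fibre-∷` reduce on the same
-- test.
δ : ∀ {n} → Fin n → Fin n → ℕ
δ u v = length (fibre id (u ∷ []) v)

sum-δ : ∀ {n} (u : Fin n) → sum (δ u) ≡ 1
sum-δ {suc n} zero    = cong suc (sum-replicate-zero n)
sum-δ {suc n} (suc u) = trans (sum-cong-≗ {n = n} δ-suc) (sum-δ u)
  where
  δ-suc : ∀ v → δ (suc u) (suc v) ≡ δ u v
  δ-suc v with u ≟ v
  ... | yes _ = refl
  ... | no _  = refl

length-fibre-∷ : ∀ {n} (f : A → Fin n) x xs v →
  length (fibre f (x ∷ xs) v) ≡ δ (f x) v + length (fibre f xs v)
length-fibre-∷ f x xs v with f x ≟ v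
... | yes _ = refl
... | no _  = refl

-- Applied to `darts`, this counts every edge twice, once by tiles and once by vertices.
sum-fibres : ∀ {n} (f : A → Fin n) (xs : List A) →
  sum (λ v → length (fibre f xs v)) ≡ length xs
sum-fibres {n = n} f []       = sum-replicate-zero n
sum-fibres {n = n} f (x ∷ xs) = begin
  sum (λ v → length (fibre f (x ∷ xs) v))
    ≡⟨ sum-cong-≗ {n = n} (length-fibre-∷ f x xs) ⟩
  sum (λ v → δ (f x) v + length (fibre f xs v))
    ≡⟨ ∑-distrib-+ (δ (f x)) _ ⟩
  sum (δ (f x)) + sum (λ v → length (fibre f xs v))
    ≡⟨ cong₂ _+_ (sum-δ (f x)) (sum-fibres f xs) ⟩
  suc (length xs) ∎
  where open ≡-Reasoning

*≤sum : ∀ {n k} (f : Fin n → ℕ) → (∀ i → k ≤ f i) → n * k ≤ sum f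
*≤sum {zero}  f k≤f = z≤n
*≤sum {suc n} f k≤f = +-mono-≤ (k≤f zero) (*≤sum (f ∘ suc) (k≤f ∘ suc))

-- The lower bounds on the other terms leave at most `k` for each one.
sum≤*⇒≤ : ∀ {n k} (f : Fin n → ℕ) → (∀ i → k ≤ f i) → sum f ≤ n * k → ∀ i → f i ≤ k
sum≤*⇒≤ {suc n} {k} f k≤f sum≤ zero    = +-cancelʳ-≤ (n * k) (f zero) k
  (≤-trans (+-monoʳ-≤ (f zero) (*≤sum (f ∘ suc) (k≤f ∘ suc))) sum≤)
sum≤*⇒≤ {suc n} {k} f k≤f sum≤ (suc i) = sum≤*⇒≤ (f ∘ suc) (k≤f ∘ suc)
  (+-cancelˡ-≤ k _ (n * k) (≤-trans (+-monoˡ-≤ _ (k≤f zero)) sum≤)) i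

-- Cycles of a function

module _ {A : Set a} (f : A → A) where
  open Endo A using (_^_)

  ^-sucʳ : ∀ n x → (f ^ n) (f x) ≡ f ((f ^ n) x)
  ^-sucʳ zero    x = refl
  ^-sucʳ (suc n) x = cong f (^-sucʳ n x)

  ∈-iterate⇒SameCycle : ∀ n {x y} → y ∈ iterate f x n → SameCycle f x y
  ∈-iterate⇒SameCycle (suc n) (here refl) = 0 , refl
  ∈-iterate⇒SameCycle (suc n) {x} (there y∈) with ∈-iterate⇒SameCycle n y∈
  ... | k , refl = suc k , sym (^-sucʳ k x)

  ∈-iterate-suc⁻ : ∀ n {x y} → y ∈ iterate f x (suc n) → y ∈ iterate f x n ⊎ y ≡ (f ^ n) x
  ∈-iterate-suc⁻ zero        (here refl) = inj₂ refl
  ∈-iterate-suc⁻ (suc n)     (here refl) = inj₁ (here refl)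
  ∈-iterate-suc⁻ (suc n) {x} (there y∈) with ∈-iterate-suc⁻ n y∈
  ... | inj₁ y∈′ = inj₁ (there y∈′)
  ... | inj₂ y≡  = inj₂ (trans y≡ (^-sucʳ n x))

  ∈-iterate-step : ∀ n {x y} → y ∈ iterate f x n → f y ∈ iterate f (f x) n
  ∈-iterate-step (suc n) (here refl) = here refl
  ∈-iterate-step (suc n) (there y∈)  = there (∈-iterate-step n y∈)

  -- Induction on the exponent: applying `f` shifts the list of iterates by one place, and the entry
  -- gained at the end is `x` by closedness.
  SameCycle⇒∈-iterate : ∀ n {x y} → (f ^ suc n) x ≡ x → SameCycle f x y →
                        y ∈ iterate f x (suc n)
  SameCycle⇒∈-iterate n     closed (zero  , refl) = here refl
  SameCycle⇒∈-iterate n {x} closed (suc k , refl)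
    with ∈-iterate-suc⁻ (suc n)
           (there (∈-iterate-step (suc n) (SameCycle⇒∈-iterate n closed (k , refl))))
  ... | inj₁ y∈ = y∈
  ... | inj₂ y≡ = here (trans y≡ closed)

  -- An orbit closing after one or two steps gives `xs` at most two entries. If none of the first
  -- three steps closes it, injectivity makes `x` and its next three iterates four distinct entries
  -- of `xs`.
  cycle-length-3 : (∀ {x y} → f x ≡ f y → x ≡ y) → (∀ x y → Dec (x ≡ y)) →
    ∀ {x xs} → Unique xs → length xs ≡ 3 →
    (∀ {y} → y ∈ xs → SameCycle f x y) → (∀ {y} → SameCycle f x y → y ∈ xs) →
    f (f (f x)) ≡ x
  cycle-length-3 injective _≟ᴬ_ {x} {xs} xs! |xs|≡3 ∈⇒cycle cycle⇒∈
    with f x ≟ᴬ x | f (f x) ≟ᴬ x | f (f (f x)) ≟ᴬ x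
  ... | _         | _          | yes f³x≡x = f³x≡x
  ... | yes fx≡x  | _          | no _ = contradiction
    (subst (_≤ 1) |xs|≡3 (unique-⊆⇒length≤ xs! (SameCycle⇒∈-iterate 0 fx≡x ∘ ∈⇒cycle)))
    λ { (s≤s ()) }
  ... | no _      | yes f²x≡x  | no _ = contradiction
    (subst (_≤ 2) |xs|≡3 (unique-⊆⇒length≤ xs! (SameCycle⇒∈-iterate 1 f²x≡x ∘ ∈⇒cycle)))
    λ { (s≤s (s≤s ())) }
  ... | no fx≢x   | no f²x≢x   | no f³x≢x = contradiction
    (subst (4 ≤_) |xs|≡3 (unique-⊆⇒length≤ orbit! (cycle⇒∈ ∘ ∈-iterate⇒SameCycle 4)))
    λ { (s≤s (s≤s (s≤s ()))) }
    where
    orbit! : Unique (iterate f x 4)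
    orbit! = ((fx≢x ∘ sym) ∷ (f²x≢x ∘ sym) ∷ (f³x≢x ∘ sym) ∷ [])
           ∷ ((fx≢x ∘ sym ∘ injective) ∷ (f²x≢x ∘ sym ∘ injective) ∷ [])
           ∷ ((fx≢x ∘ sym ∘ injective ∘ injective) ∷ [])
           ∷ []
           ∷ []

-- Darts of a finite graph

module _ (G : Graph) where
  open Graph G

  length-darts : length darts ≡ #edges * 2
  length-darts = trans (length-cartesianProduct (allFin #edges) (false ∷ true ∷ []))
    (cong (_* 2) (length-tabulate {n = #edges} id))

  ∈-darts : ∀ d → d ∈ darts
  ∈-darts (e , false) = ∈-cartesianProduct⁺ (∈-allFin e) (here refl)
  ∈-darts (e , true)  = ∈-cartesianProduct⁺ (∈-allFin e) (there (here refl))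

  darts-unique : Unique darts
  darts-unique = Unique.cartesianProduct⁺ (Unique.allFin⁺ #edges)
    (((λ ()) ∷ []) ∷ [] ∷ [])

  _≟ᵈ_ : (d d′ : Dart) → Dec (d ≡ d′)
  _≟ᵈ_ = Product.≡-dec _≟_ Bool._≟_

  reverse-involutive : ∀ d → reverse (reverse d) ≡ d
  reverse-involutive (e , b) = cong (e ,_) (not-involutive b)

-- Twelve pentagons force degree 3

module TwelvePentagons (T : SphericalTiling)
  (#tiles≡12 : SphericalTiling.#tiles T ≡ 12)
  (pentagons : SphericalTiling.AllPentagons T)
  where
  open SphericalTiling T
  private
    module IsPentagon′ d = IsPentagon (pentagons d)
    rotate : Dart → Dart
    rotate = Inverse.to rotation

  boundary⇒same-tile : ∀ {d d′} → d′ ∈ boundary₅ d → tile d ≡ tile d′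
  boundary⇒same-tile d′∈ = Equivalence.from (tile-cycle _ _) (∈-iterate⇒SameCycle next 5 d′∈)

  same-tile⇒boundary : ∀ {d d′} → tile d ≡ tile d′ → d′ ∈ boundary₅ d
  same-tile⇒boundary {d} eq = SameCycle⇒∈-iterate next 4 (IsPentagon′.closed d)
    (Equivalence.to (tile-cycle _ _) eq)

  5≤tile-size : ∀ t → 5 ≤ length (fibre tile darts t)
  5≤tile-size t with tile-surjective t
  ... | d , refl = unique-⊆⇒length≤ (Unique.map⁻ {f = edge} (IsPentagon′.distinct-edges d))
    (λ d′∈ → ∈-filter⁺ (λ e → tile e ≟ tile d) (∈-darts graph _) (sym (boundary⇒same-tile d′∈)))

  -- The twelve tiles account for at least sixty darts, two for each edge.
  30≤#edges : 30 ≤ #edges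
  30≤#edges = *-cancelʳ-≤ 30 #edges 2 (begin
    60                                      ≡⟨ cong (_* 5) #tiles≡12 ⟨
    #tiles * 5                              ≤⟨ *≤sum _ 5≤tile-size ⟩
    sum (λ t → length (fibre tile darts t)) ≡⟨ sum-fibres tile darts ⟩
    length darts                            ≡⟨ length-darts graph ⟩
    #edges * 2                              ∎)
    where open ≤-Reasoning

  #vertices+10≡#edges : #vertices + 10 ≡ #edges
  #vertices+10≡#edges = +-cancelʳ-≡ 2 _ _ (begin
    #vertices + 10 + 2  ≡⟨ +-assoc #vertices 10 2 ⟩
    #vertices + 12      ≡⟨ cong (#vertices +_) #tiles≡12 ⟨
    #vertices + #tiles  ≡⟨ euler ⟩
    #edges + 2          ∎)
    where open ≡-Reasoning

  -- With V vertices and E edges, the degree sum is 2E, and 2E + 30 ≤ 3E = 3(V + 10). The 30 is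
  -- added to both sides to avoid subtraction.
  sum-degrees≤ : sum degree ≤ #vertices * 3
  sum-degrees≤ = +-cancelʳ-≤ 30 _ _ (begin
    sum degree + 30        ≡⟨ cong (_+ 30) (trans (sum-fibres source darts) (length-darts graph)) ⟩
    #edges * 2 + 30        ≤⟨ +-monoʳ-≤ (#edges * 2) 30≤#edges ⟩
    #edges * 2 + #edges    ≡⟨ +-comm (#edges * 2) #edges ⟩
    #edges + #edges * 2    ≡⟨ *-suc #edges 2 ⟨
    #edges * 3             ≡⟨ cong (_* 3) #vertices+10≡#edges ⟨
    (#vertices + 10) * 3   ≡⟨ *-distribʳ-+ 3 #vertices 10 ⟩
    #vertices * 3 + 30     ∎)
    where open ≤-Reasoning

  degree≡3 : ∀ v → degree v ≡ 3
  degree≡3 v = ≤-antisym (sum≤*⇒≤ degree degree≥3 sum-degrees≤ v) (degree≥3 v)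

  -- The darts at the source of `d` form one cycle of the rotation, and there are three of them.
  rotate³ : ∀ d → rotate (rotate (rotate d)) ≡ d
  rotate³ d = cycle-length-3 rotate
    (λ eq → trans (sym (Inverse.strictlyInverseʳ rotation _))
              (trans (cong (Inverse.from rotation) eq) (Inverse.strictlyInverseʳ rotation _)))
    (_≟ᵈ_ graph)
    (Unique.filter⁺ at-source? (darts-unique graph))
    (degree≡3 (source d))
    (λ d′∈ → Equivalence.to (rotation-cycle _ _)
      (sym (proj₂ (∈-filter⁻ at-source? {xs = darts} d′∈))))
    (λ cycle → ∈-filter⁺ at-source? (∈-darts graph _)
      (sym (Equivalence.from (rotation-cycle _ _) cycle)))
    where
    at-source? : ∀ d′ → Dec (source d′ ≡ source d)
    at-source? d′ = source d′ ≟ source d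

  next-reverse≡rotate : ∀ d → next (reverse d) ≡ rotate d
  next-reverse≡rotate d = cong rotate (reverse-involutive graph d)

  next-reverse³ : ∀ d → next (reverse (next (reverse (next (reverse d))))) ≡ d
  next-reverse³ d = begin
    next (reverse (next (reverse (next (reverse d)))))
      ≡⟨ next-reverse≡rotate _ ⟩
    rotate (next (reverse (next (reverse d))))
      ≡⟨ cong rotate (next-reverse≡rotate _) ⟩
    rotate (rotate (next (reverse d)))
      ≡⟨ cong (rotate ∘ rotate) (next-reverse≡rotate d) ⟩
    rotate (rotate (rotate d))
      ≡⟨ rotate³ d ⟩
    d ∎
    where open ≡-Reasoning

  open CubicPentagonalMap next reverse (λ d → IsPentagon′.closed d)
    (reverse-involutive graph) next-reverse³ public

  someDart : Dart
  someDart = proj₁ (tile-surjective (subst Fin (sym #tiles≡12) zero))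

  module _ {P : Dart → Set p} (oneP : OneEdgePerTile P) where
    open OneEdgePerTile oneP

    exists-in-tile : ∀ d → ∃[ d′ ] tile d ≡ tile d′ × P d′
    exists-in-tile d with exists^ d
    ... | k , Pd′ = _ , Equivalence.from (tile-cycle _ _) (k , refl) , Pd′

    unique-in-tile : ∀ {d d′} → tile d ≡ tile d′ → P d → P d′ → d ≡ d′
    unique-in-tile {d} eq Pd Pd′ with same-tile⇒boundary eq
    ... | here refl = refl
    ... | there d′∈ = contradiction Pd′
      (All.lookup (AllPairs.head (at-most-one d)) d′∈ Pd)

-- Edge lengths and edge congruence

module _ {c ℓ} (Length : Setoid c ℓ) (T : SphericalTiling)
  (#tiles≡12 : SphericalTiling.#tiles T ≡ 12)
  {len : SphericalTiling.Edge T → Setoid.Carrier Length} {ls}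
  (tiling : IsTilingByEdgeCongruentPentagons Length T len ls)
  where
  open Setoid Length using (Carrier; _≈_) renaming (sym to ≈-sym; trans to ≈-trans)
  open Permutation Length using (↭-sym)
  open SphericalTiling T
  open IsTilingByEdgeCongruentPentagons tiling
  open TwelvePentagons T #tiles≡12 pentagons

  HasLength : Carrier → Dart → Set ℓ
  HasLength x d = len (edge d) ≈ x

  oneEdgePerTile : ∀ {x} → Any (_≈ x) ls → AllPairs (λ y z → y ≈ x → ¬ z ≈ x) ls →
                   OneEdgePerTile (HasLength x)
  oneEdgePerTile {x} any pairs = record
    { reversed    = id
    ; exists      = λ d → Any.map⁻
        (Permutationₚ.Any-resp-↭ Length resp (ls↭ d) any)
    ; at-most-one = λ d → AllPairs.map⁻
        -- Mutual exclusion is symmetric and respects `≈`, so it survives reordering `ls` into the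
        -- boundary.
        (Permutationₚ.AllPairs-resp-↭ Length (λ ¬yz z≈ y≈ → ¬yz y≈ z≈)
          ((λ y≈z ¬wy w≈ z≈ → ¬wy w≈ (resp (≈-sym y≈z) z≈)) ,
           (λ y≈z ¬yw z≈ → ¬yw (resp (≈-sym y≈z) z≈)))
          (ls↭ d) pairs)
    }
    where
    resp : ∀ {y z} → y ≈ z → y ≈ x → z ≈ x
    resp y≈z y≈x = ≈-trans (≈-sym y≈z) y≈x
    ls↭ = λ d → ↭-sym (edge-lengths (tile d) d refl)

  module _ {b c} (oneB : OneEdgePerTile (HasLength b)) (oneC : OneEdgePerTile (HasLength c))
    where

    Adjacent : Dart → Dart → Set
    Adjacent d d′ = next d ≡ d′ ⊎ next d′ ≡ d

    -- A length-preserving correspondence must send `d` to `e` and `d′` to `e′`, as these are the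
    -- only sides of their lengths in the second tile.
    adjacency-invariant : ∀ {d d′ e e′} →
      HasLength b d → HasLength c d′ → tile d ≡ tile d′ →
      HasLength b e → HasLength c e′ → tile e ≡ tile e′ →
      Adjacent d d′ → Adjacent e e′
    adjacency-invariant {d} {d′} {e} {e′} bd cd′ d∼d′ be ce′ e∼e′ adjacent =
      subst₂ Adjacent
        (unique-in-tile oneB (proj₂ (to x)) (≈-trans (preserves-length x) bd) be)
        (unique-in-tile oneC (trans (proj₂ (to y)) e∼e′) (≈-trans (preserves-length y) cd′) ce′)
        (preserves-adjacency x y adjacent)
      where
      open EdgeCongruent (edge-congruent (tile d) (tile e))
      open Inverse correspondence using (to)
      x y : Side (tile d)
      x = d  , refl
      y = d′ , sym d∼d′

    no-tiling : ¬ ¬ b ≈ c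
    no-tiling b≉c with exists-in-tile oneB someDart | exists-in-tile oneC someDart
    ... | p , ∼p , bp | q , ∼q , cq
      -- Adjacency is decided in one tile only; `adjacency-invariant` carries the answer to all
      -- others.
      with _≟ᵈ_ graph (next p) q ⊎-dec _≟ᵈ_ graph (next q) p
    ... | no nonadjacent = ¬nonadjacent oneB oneC someDart
      (λ bd cd → b≉c (≈-trans (≈-sym bd) cd))
      (λ bd cd′ → nonadjacent (adjacency-invariant bd cd′ next-same-tile bp cq p∼q (inj₁ refl)))
      (λ cd bd′ → nonadjacent (adjacency-invariant bd′ cd (sym next-same-tile) bp cq p∼q (inj₂ refl)))
      where
      p∼q = trans (sym ∼p) ∼q
      next-same-tile : ∀ {d} → tile d ≡ tile (next d)
      next-same-tile = boundary⇒same-tile (there (here refl))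
    ... | yes adjacent = ¬adjacent oneB oneC someDart B-adjacent C-adjacent
      where
      p∼q = trans (sym ∼p) ∼q
      B-adjacent : ∀ {d} → HasLength b d → HasLength c (next d) ⊎ HasLength c (prev d)
      B-adjacent {d} bd with exists-in-tile oneC d
      ... | d′ , d∼d′ , cd′ with adjacency-invariant bp cq p∼q bd cd′ d∼d′ adjacent
      ... | inj₁ refl = inj₁ cd′
      ... | inj₂ eq   = inj₂ (subst (HasLength c) (next≡⇒≡prev eq) cd′)
      C-adjacent : ∀ {d} → HasLength c d → HasLength b (next d) ⊎ HasLength b (prev d)
      C-adjacent {d} cd with exists-in-tile oneB d
      ... | d′ , d∼d′ , bd′ with adjacency-invariant bp cq p∼q bd′ cd (sym d∼d′) adjacent
      ... | inj₁ eq   = inj₂ (subst (HasLength b) (next≡⇒≡prev eq) bd′)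
      ... | inj₂ refl = inj₁ bd′

proposition11 : ∀ {ℓ₁ ℓ₂} (Length : Setoid ℓ₁ ℓ₂) →
    let open Setoid Length
        open SphericalTiling in
    (a b c : Carrier) → ¬ (a ≈ b) → ¬ (a ≈ c) → ¬ (b ≈ c) →
    ¬ (Σ SphericalTiling λ T →
       Σ (Edge T → Carrier) λ len →
         #tiles T ≡ 12 ×
         IsTilingByEdgeCongruentPentagons Length T len (a ∷ a ∷ a ∷ b ∷ c ∷ []))
proposition11 Length a b c a≉b a≉c b≉c (T , len , #tiles≡12 , tiling) =
  no-tiling Length T #tiles≡12 tiling
    (oneEdgePerTile Length T #tiles≡12 tiling
      (there (there (there (here ≈.refl))))
      -- A pair starting with `a` fails to be `b` twice at its first entry, the pair of `b` and `c`
      -- at its second.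
      ( (a≉b′ ∷ a≉b′ ∷ a≉b′ ∷ a≉b′ ∷ [])
      ∷ (a≉b′ ∷ a≉b′ ∷ a≉b′ ∷ [])
      ∷ (a≉b′ ∷ a≉b′ ∷ [])
      ∷ ((λ _ c≈b → b≉c (≈.sym c≈b)) ∷ [])
      ∷ [] ∷ []))
    (oneEdgePerTile Length T #tiles≡12 tiling
      (there (there (there (there (here ≈.refl)))))
      -- For `c`, every pair fails at its first entry.
      ( (a≉c′ ∷ a≉c′ ∷ a≉c′ ∷ a≉c′ ∷ [])
      ∷ (a≉c′ ∷ a≉c′ ∷ a≉c′ ∷ [])
      ∷ (a≉c′ ∷ a≉c′ ∷ [])
      ∷ ((λ b≈c _ → b≉c b≈c) ∷ [])
      ∷ [] ∷ []))
    b≉c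
  where
  module ≈ = Setoid Length
  a≉b′ : ∀ {x} → a ≈.≈ b → ¬ x ≈.≈ b
  a≉b′ a≈b _ = a≉b a≈b
  a≉c′ : ∀ {x} → a ≈.≈ c → ¬ x ≈.≈ c
  a≉c′ a≈c _ = a≉c a≈c
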